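{- Let $d, w \in \mathbb{N}$ with $d > 1$ and $0 \leq w < 2^{d-1}$. Let $s = (s_0,\dotsc,s_{n-1})$ ($n \ge 0$) and $t = (t_0,\dotsc,t_{m-1})$ ($m \ge 1$) be Boolean input variables with arrival times in $\mathbb{N}$ such that $W(s) = w$ and \[ W(t) \leq 1.9 \cdot \frac{2^{d-1} - w}{d \log_2 (d)}. \] Then there is a Boolean circuit over $\{\land,\lor\}$ realizing $f(s, t)$ with delay at most $d$.
   Context: For Boolean variables $t = (t_0, \dotsc, t_{m-1})$ with $m \geq 1$, define recursively $g(t) = g^*(t) = t_0$ if $m=1$, and for $m>1$, $g(t) = t_0 \land g^*((t_1, \dotsc, t_{m-1}))$, $g^*(t) = t_0 \lor g((t_1, \dotsc, t_{m-1}))$. For $s = (s_0,\dotsc,s_{n-1})$ (possibly empty), $f(s,t) = s_0 \land \dotsb \land s_{n-1} \land g(t)$. A Boolean circuit over $\{\land,\lor\}$ is a directed acyclic graph whose indegree-0 nodes (inputs) are labeled by Boolean variables, with a unique outdegree-0 node (output) of indegree 1, and all other nodes are gates of indegree exactly 2 labeled \textsc{And} or \textsc{Or}; it realizes a Boolean function if its output computes that function for all input values. Each input variable $x$ has an arrival time $a(x) \in \mathbb{N}$; the delay of input $x$ is $a(x)$ plus the maximum number of gates on any directed path starting at $x$, and the delay of the circuit is the maximum delay over its inputs. The weight of an input is $W(x) = 2^{a(x)}$, and the weight of a tuple of inputs is the sum of the weights of its entries (empty tuple: $0$). -}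

module Defs where

open import Data.Nat using (ℕ; zero; suc; _+_; _*_; _∸_; _^_; _≤_; _<_; _⊔_)
open import Data.Fin using (Fin; zero; suc)
open import Data.Bool using (Bool; true; false; _∧_; _∨_)
open import Data.Sum using (_⊎_; inj₁; inj₂)
open import Data.Product using (_×_; Σ)
open import Relation.Binary.PropositionalEquality using (_≡_)

sumFin : {n : ℕ} → (Fin n → ℕ) → ℕ
sumFin {zero}  f = 0
sumFin {suc n} f = f zero + sumFin (λ i → f (suc i))

andFin : {n : ℕ} → (Fin n → Bool) → Bool
andFin {zero}  f = true
andFin {suc n} f = f zero ∧ andFin (λ i → f (suc i))

-- The functions g, g*, f.  A tuple t = (t_0,…,t_{m-1}) with m ≥ 1 is a
-- map Fin (suc k) → Bool (so m = suc k).

mutual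
  g : {k : ℕ} → (Fin (suc k) → Bool) → Bool
  g {zero}  t = t zero
  g {suc k} t = t zero ∧ g* (λ i → t (suc i))

  g* : {k : ℕ} → (Fin (suc k) → Bool) → Bool
  g* {zero}  t = t zero
  g* {suc k} t = t zero ∨ g (λ i → t (suc i))

-- Input variables: s_0..s_{n-1} are inj₁ i, t_0..t_{m-1} are inj₂ j.
Var : ℕ → ℕ → Set
Var n k = Fin n ⊎ Fin (suc k)

f : {n k : ℕ} → (Var n k → Bool) → Bool
f ρ = andFin (λ i → ρ (inj₁ i)) ∧ g (λ j → ρ (inj₂ j))

-- Boolean circuits over {∧,∨} as DAGs in topological order.
-- A node visible at stage j is either an input node (one per variable)
-- or one of the j gates built so far. Gates are stored newest-first:
-- in (γ ∷ γs) : Gates V (suc j), gate node `zero` is γ and `suc i`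
-- refers to gate i of γs. Each gate has exactly two predecessors
-- among the earlier nodes.

data Op : Set where
  AND OR : Op

apply : Op → Bool → Bool → Bool
apply AND x y = x ∧ y
apply OR  x y = x ∨ y

Node : Set → ℕ → Set
Node V j = V ⊎ Fin j

record Gate (V : Set) (j : ℕ) : Set where
  constructor gate
  field
    op    : Op
    left  : Node V j
    right : Node V j

data Gates (V : Set) : ℕ → Set where
  []  : Gates V 0
  _∷_ : {j : ℕ} → Gate V j → Gates V j → Gates V (suc j)

-- A circuit: `size` gates, and the output node (of indegree 1) whose
-- unique predecessor is the node `out`.
record Circuit (V : Set) : Set where
  constructor circuit
  field
    size  : ℕ
    gates : Gates V size
    out   : Node V size

evalN : {V : Set} {j : ℕ} → (V → Bool) → Gates V j → Node V j → Bool
evalN ρ gs       (inj₁ x)       = ρ x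
evalN ρ (γ ∷ gs) (inj₂ zero)    =
  apply (Gate.op γ) (evalN ρ gs (Gate.left γ)) (evalN ρ gs (Gate.right γ))
evalN ρ (γ ∷ gs) (inj₂ (suc i)) = evalN ρ gs (inj₂ i)

eval : {V : Set} → (V → Bool) → Circuit V → Bool
eval ρ C = evalN ρ (Circuit.gates C) (Circuit.out C)

Realizes : {V : Set} → Circuit V → ((V → Bool) → Bool) → Set
Realizes C F = ∀ ρ → eval ρ C ≡ F ρ

-- nodeDelay a gs v = max over inputs x and directed paths x ⇝ v of
-- a(x) + (number of gates on the path, including v if v is a gate).
nodeDelay : {V : Set} {j : ℕ} → (V → ℕ) → Gates V j → Node V j → ℕ
nodeDelay a gs       (inj₁ x)       = a x
nodeDelay a (γ ∷ gs) (inj₂ zero)    =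
  suc (nodeDelay a gs (Gate.left γ) ⊔ nodeDelay a gs (Gate.right γ))
nodeDelay a (γ ∷ gs) (inj₂ (suc i)) = nodeDelay a gs (inj₂ i)

-- The delay of C is ≤ d: the paper's delay is the max over inputs x of
-- a(x) + max #gates on a path from x, which equals the max of nodeDelay
-- over all nodes (input nodes and gates).
DelayAtMost : {V : Set} → (V → ℕ) → Circuit V → ℕ → Set
DelayAtMost a C d =
  (∀ x → a x ≤ d) ×
  (∀ (i : Fin (Circuit.size C)) → nodeDelay a (Circuit.gates C) (inj₂ i) ≤ d)

W : {n : ℕ} → (Fin n → ℕ) → ℕ
W arr = sumFin (λ i → 2 ^ arr i)

{-# OPTIONS --safe #-}
-- Since 1.9 (d - 1) ≤ d log₂ d, the hypothesis gives (d - 1) W(t) + W(s) ≤ 2^(d-1).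
-- More generally, with e = d - 1 ≥ 1 and s nonempty, a formula of delay d exists for
-- s₀ ∧ ... ∧ sₙ₋₁ ∧ (t₀ ∨ (t₁ ∧ ...)), and dually, as soon as
--   W(s) + e (weight of all entries of t but the last) + (weight of the last) ≤ 2^e.
-- For the step from e to e + 1, cut t = P ++ y ∷ R with P of even length and distribute:
-- the function is the conjunction of the same kind of function of (s, P) and the dual
-- kind of function of (even entries of P and y, R). Let P be the shortest prefix for which the
-- second part meets its budget 2^e. When the previous prefix fails this test, the excess
-- over 2^e is saved on the other side, so that (s, P) meets its budget as well.
module Submission where

open import Defs
open import Data.Bool using (Bool; true; false; _∧_; _∨_)
open import Data.Bool.Properties using (∧-assoc; ∨-assoc; ∧-comm; ∨-comm; ∧-identityʳ; ∨-identityʳ; ∧-distribˡ-∨; ∨-distribˡ-∧)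
open import Data.Empty using (⊥-elim)
open import Data.Fin using (Fin; zero; suc)
open import Data.List using (List; []; _∷_; map; foldr; tabulate)
open import Data.Nat.ListAction using (sum)
open import Data.Nat using (ℕ; zero; suc; _+_; _*_; _∸_; _^_; _≤_; _<_; z≤n; s≤s; s≤s⁻¹; _≤?_)
open import Data.Nat.Properties
open import Data.Nat.Tactic.RingSolver using (solve-∀)
open import Data.Product using (Σ; _×_; _,_; proj₁; proj₂)
open import Data.Sum using (_⊎_; inj₁; inj₂)
open import Function using (_∘_)
open import Relation.Nullary using (yes; no)
open import Relation.Binary.PropositionalEquality using (_≡_; refl; sym; trans; cong; cong₂; subst; module ≡-Reasoning)

-- The two operators and the alternating functions built from them

dual : Op → Op
dual AND = OR
dual OR  = AND

dual-involutive : ∀ o → dual (dual o) ≡ o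
dual-involutive AND = refl
dual-involutive OR  = refl

unit : Op → Bool
unit AND = true
unit OR  = false

apply-assoc : ∀ o x y z → apply o (apply o x y) z ≡ apply o x (apply o y z)
apply-assoc AND = ∧-assoc
apply-assoc OR  = ∨-assoc

apply-comm : ∀ o x y → apply o x y ≡ apply o y x
apply-comm AND = ∧-comm
apply-comm OR  = ∨-comm

apply-unitˡ : ∀ o x → apply o (unit o) x ≡ x
apply-unitˡ AND _ = refl
apply-unitˡ OR  _ = refl

apply-unitʳ : ∀ o x → apply o x (unit o) ≡ x
apply-unitʳ AND = ∧-identityʳ
apply-unitʳ OR  = ∨-identityʳ

apply-distribˡ-dual : ∀ o x y z →
  apply o x (apply (dual o) y z) ≡ apply (dual o) (apply o x y) (apply o x z)
apply-distribˡ-dual AND = ∧-distribˡ-∨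
apply-distribˡ-dual OR  = ∨-distribˡ-∧

apply-absorbing : ∀ o x → apply o x (unit (dual o)) ≡ unit (dual o)
apply-absorbing AND x = ∧-comm x false
apply-absorbing OR  x = ∨-comm x true

apply-left-comm : ∀ o x y z → apply o x (apply o y z) ≡ apply o y (apply o x z)
apply-left-comm o x y z = begin
  apply o x (apply o y z)  ≡⟨ apply-assoc o x y z ⟨
  apply o (apply o x y) z  ≡⟨ cong (λ u → apply o u z) (apply-comm o x y) ⟩
  apply o (apply o y x) z  ≡⟨ apply-assoc o y x z ⟩
  apply o y (apply o x z)  ∎
  where open ≡-Reasoning

big : {A : Set} → Op → (A → Bool) → List A → Bool
big o v = foldr (λ x → apply o (v x)) (unit o)

-- The value at [] is the one making alt o (x ∷ []) equal to x.
alt : {A : Set} → Op → (A → Bool) → List A → Bool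
alt o v []       = unit (dual o)
alt o v (x ∷ xs) = apply o (v x) (alt (dual o) v xs)

extended : {V : Set} → Op → List V → List V → (V → Bool) → Bool
extended o S t ρ = apply o (big o ρ S) (alt (dual o) ρ t)

extended-[] : ∀ {V : Set} o (S : List V) ρ → extended o S [] ρ ≡ big o ρ S
extended-[] o S ρ rewrite dual-involutive o = apply-unitʳ o _

extended-singleton : ∀ {V : Set} o S (v : V) ρ → extended o S (v ∷ []) ρ ≡ big o ρ (v ∷ S)
extended-singleton o S v ρ rewrite dual-involutive (dual o) =
  trans (cong (apply o _) (apply-unitʳ (dual o) _)) (apply-comm o _ _)

extended-∷ : ∀ {V : Set} o Q (y : V) t ρ →
  apply o (big o ρ Q) (alt o ρ (y ∷ t)) ≡ extended o (y ∷ Q) t ρ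
extended-∷ o Q y t ρ = trans (apply-left-comm o _ _ _) (sym (apply-assoc o _ _ _))

-- Distributivity splits off the same operand, v joined by `o` to y and `Q`, for `t` and for `P`.
-- What is left is the equation for `y ∷ Q`, so `C` stays unchanged when the prefix grows by y and
-- v.
split-later : ∀ {V : Set} o Q (y : V) v t P C ρ →
  apply o (big o ρ (y ∷ Q)) (alt o ρ t) ≡ apply (dual o) (apply o (big o ρ (y ∷ Q)) (alt o ρ P)) C →
  apply o (big o ρ Q) (alt o ρ (y ∷ v ∷ t)) ≡
    apply (dual o) (apply o (big o ρ Q) (alt o ρ (y ∷ v ∷ P))) C
split-later o Q y v t P C ρ eq rewrite dual-involutive o = begin
  apply o (big o ρ Q) (apply o (ρ y) (apply (dual o) (ρ v) (alt o ρ t)))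
    ≡⟨ regroup t ⟩
  apply (dual o) (apply o q (ρ v)) (apply o q (alt o ρ t))
    ≡⟨ cong (apply (dual o) _) eq ⟩
  apply (dual o) (apply o q (ρ v)) (apply (dual o) (apply o q (alt o ρ P)) C)
    ≡⟨ apply-assoc (dual o) _ _ _ ⟨
  apply (dual o) (apply (dual o) (apply o q (ρ v)) (apply o q (alt o ρ P))) C
    ≡⟨ cong (λ u → apply (dual o) u C) (regroup P) ⟨
  apply (dual o) (apply o (big o ρ Q) (apply o (ρ y) (apply (dual o) (ρ v) (alt o ρ P)))) C
    ∎
  where
  open ≡-Reasoning
  q = big o ρ (y ∷ Q)
  regroup : ∀ s → apply o (big o ρ Q) (apply o (ρ y) (apply (dual o) (ρ v) (alt o ρ s))) ≡
    apply (dual o) (apply o q (ρ v)) (apply o q (alt o ρ s))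
  regroup s = begin
    apply o (big o ρ Q) (apply o (ρ y) (apply (dual o) (ρ v) (alt o ρ s)))
      ≡⟨ trans (apply-left-comm o _ _ _) (sym (apply-assoc o _ _ _)) ⟩
    apply o q (apply (dual o) (ρ v) (alt o ρ s))
      ≡⟨ apply-distribˡ-dual o _ _ _ ⟩
    apply (dual o) (apply o q (ρ v)) (apply o q (alt o ρ s))
      ∎

weight : {A : Set} → (A → ℕ) → List A → ℕ
weight r xs = sum (map (λ x → 2 ^ r x) xs)

weight-nonempty : {A : Set} (r : A → ℕ) (x : A) (xs : List A) → 0 < weight r (x ∷ xs)
weight-nonempty r x xs = m≤n⇒m≤n+o (weight r xs) (m^n>0 2 (r x))

-- Balanced combination of terms with prescribed delays (Kraft's inequality)

-- `Term` is abstract so that `raise` can renumber the levels; `kraft` then lowers the delay bound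
-- and the item levels together.
record Levelled (Env : Set) (o : Op) : Set₁ where
  field
    Term      : ℕ → Set
    ⟦_⟧       : ∀ {d} → Term d → Env → Bool
    join      : ∀ {d} → Term d → Term d → Term (suc d)
    ⟦join⟧    : ∀ {d} (x y : Term d) ρ → ⟦ join x y ⟧ ρ ≡ apply o (⟦ x ⟧ ρ) (⟦ y ⟧ ρ)
    delay     : ∀ {d} → Term d → Term (suc d)
    ⟦delay⟧   : ∀ {d} (x : Term d) ρ → ⟦ delay x ⟧ ρ ≡ ⟦ x ⟧ ρ

  Item : Set
  Item = Σ ℕ Term

  total : List Item → Env → Bool
  total xs ρ = big o (λ x → ⟦ proj₂ x ⟧ ρ) xs

module _ {Env : Set} {o : Op} where

  open Levelled using (Item; total)

  raise : Levelled Env o → Levelled Env o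
  raise L = record
    { Term = Term ∘ suc ; ⟦_⟧ = ⟦_⟧ ; join = join ; ⟦join⟧ = ⟦join⟧ ; delay = delay ; ⟦delay⟧ = ⟦delay⟧ }
    where open Levelled L

  data Halved (L : Levelled Env o) (xs : List (Item L)) : Set where
    even : (ys : List (Item (raise L))) → 2 * weight proj₁ ys ≡ weight proj₁ xs →
           (∀ ρ → total (raise L) ys ρ ≡ total L xs ρ) → Halved L xs
    odd  : (x : Levelled.Term L 0) (ys : List (Item (raise L))) →
           suc (2 * weight proj₁ ys) ≡ weight proj₁ xs →
           (∀ ρ → apply o (Levelled.⟦_⟧ L x ρ) (total (raise L) ys ρ) ≡ total L xs ρ) → Halved L xs

  -- Items of positive level drop by one. Items of level 0 are joined in pairs, and a pair has level
  -- 1, which is level 0 after `raise`. One item is left over exactly when the weight is odd.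
  halve : (L : Levelled Env o) (xs : List (Item L)) → Halved L xs
  halve L [] = even [] refl (λ _ → refl)
  halve L ((suc r , x) ∷ xs) with halve L xs
  ... | even ys w≡ v≡ = even ((r , x) ∷ ys)
        (trans (*-distribˡ-+ 2 (2 ^ r) (weight proj₁ ys)) (cong (2 ^ suc r +_) w≡))
        (λ ρ → cong (apply o _) (v≡ ρ))
  ... | odd y ys w≡ v≡ = odd y ((r , x) ∷ ys)
        (trans (lemma (2 ^ r) (weight proj₁ ys)) (cong (2 ^ suc r +_) w≡))
        (λ ρ → trans (apply-left-comm o _ _ _) (cong (apply o _) (v≡ ρ)))
    where
    lemma : ∀ p q → suc (2 * (p + q)) ≡ 2 * p + suc (2 * q)
    lemma = solve-∀
  halve L ((zero , x) ∷ xs) with halve L xs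
  ... | even ys w≡ v≡ = odd x ys (cong suc w≡) (λ ρ → cong (apply o _) (v≡ ρ))
  ... | odd y ys w≡ v≡ = even ((0 , join x y) ∷ ys)
        (trans (*-distribˡ-+ 2 1 (weight proj₁ ys)) (cong suc w≡))
        (λ ρ → trans (cong (λ u → apply o u (total (raise L) ys ρ)) (⟦join⟧ x y ρ))
                 (trans (apply-assoc o _ _ _) (cong (apply o _) (v≡ ρ))))
    where open Levelled L using (join; ⟦join⟧)

  kraft : (d : ℕ) (L : Levelled Env o) (xs : List (Item L)) →
    0 < weight proj₁ xs → weight proj₁ xs ≤ 2 ^ d →
    Σ (Levelled.Term L d) (λ x → ∀ ρ → Levelled.⟦_⟧ L x ρ ≡ total L xs ρ)
  kraft zero L ((zero , x) ∷ []) _ _ = x , λ ρ → sym (apply-unitʳ o _)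
  kraft zero L ((zero , x) ∷ y ∷ ys) _ w≤ =
    ⊥-elim (<⇒≱ (weight-nonempty proj₁ y ys) (s≤s⁻¹ w≤))
  kraft zero L ((suc r , x) ∷ xs) _ w≤ =
    ⊥-elim (<⇒≱ (*-monoʳ-≤ 2 (m^n>0 2 r)) (m+n≤o⇒m≤o _ w≤))
  kraft (suc d) L xs 0< w≤ with halve L xs
  ... | even ys w≡ v≡ =
    let x , x≡ = kraft d (raise L) ys
          (*-cancelˡ-< 2 0 _ (subst (0 <_) (sym w≡) 0<))
          (*-cancelˡ-≤ 2 (subst (_≤ 2 ^ suc d) (sym w≡) w≤))
    in x , λ ρ → trans (x≡ ρ) (v≡ ρ)
  ... | odd y ys w≡ v≡ =
    -- An odd weight cannot equal 2^(d+1), so the halved list has room for the leftover, delayed to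
    -- level 1 and counted with weight 1.
    let x , x≡ = kraft d (raise L) ((0 , delay y) ∷ ys) (s≤s z≤n)
          (*-cancelˡ-< 2 _ _ (subst (_≤ 2 ^ suc d) (sym w≡) w≤))
    in x , λ ρ → trans (x≡ ρ) (trans (cong (λ u → apply o u (total (raise L) ys ρ)) (⟦delay⟧ y ρ)) (v≡ ρ))
    where open Levelled L using (delay; ⟦delay⟧)

-- Formulas of bounded delay

data Formula {V : Set} (a : V → ℕ) : ℕ → Set where
  var  : ∀ {d} (x : V) → a x ≤ d → Formula a d
  node : ∀ {d} → Op → Formula a d → Formula a d → Formula a (suc d)

module _ {V : Set} {a : V → ℕ} where

  ⟦_⟧ : ∀ {d} → Formula a d → (V → Bool) → Bool
  ⟦ var x _ ⟧ ρ    = ρ x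
  ⟦ node o l r ⟧ ρ = apply o (⟦ l ⟧ ρ) (⟦ r ⟧ ρ)

  weaken : ∀ {d} → Formula a d → Formula a (suc d)
  weaken (var x x≤)   = var x (m≤n⇒m≤1+n x≤)
  weaken (node o l r) = node o (weaken l) (weaken r)

  ⟦weaken⟧ : ∀ {d} (φ : Formula a d) ρ → ⟦ weaken φ ⟧ ρ ≡ ⟦ φ ⟧ ρ
  ⟦weaken⟧ (var x x≤) ρ   = refl
  ⟦weaken⟧ (node o l r) ρ = cong₂ (apply o) (⟦weaken⟧ l ρ) (⟦weaken⟧ r ρ)

  formulas : ∀ o → Levelled (V → Bool) o
  formulas o = record
    { Term = Formula a ; ⟦_⟧ = ⟦_⟧ ; join = node o ; ⟦join⟧ = λ _ _ _ → refl
    ; delay = weaken ; ⟦delay⟧ = ⟦weaken⟧ }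

  leaf : V → Σ ℕ (Formula a)
  leaf x = a x , var x ≤-refl

  weight-leaves : ∀ xs → weight proj₁ (map leaf xs) ≡ weight a xs
  weight-leaves []       = refl
  weight-leaves (x ∷ xs) = cong (2 ^ a x +_) (weight-leaves xs)

  total-leaves : ∀ o xs ρ → Levelled.total (formulas o) (map leaf xs) ρ ≡ big o ρ xs
  total-leaves o []       ρ = refl
  total-leaves o (x ∷ xs) ρ = cong (apply o (ρ x)) (total-leaves o xs ρ)

  FormulaFor : ℕ → ((V → Bool) → Bool) → Set
  FormulaFor d F = Σ (Formula a d) (λ φ → ∀ ρ → ⟦ φ ⟧ ρ ≡ F ρ)

  big-formula : ∀ d o x xs → weight a (x ∷ xs) ≤ 2 ^ d → FormulaFor d (λ ρ → big o ρ (x ∷ xs))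
  big-formula d o x xs w≤ =
    let φ , φ≡ = kraft d (formulas o) (map leaf (x ∷ xs)) (weight-nonempty proj₁ (leaf x) (map leaf xs))
                   (subst (_≤ 2 ^ d) (sym (weight-leaves (x ∷ xs))) w≤)
    in φ , λ ρ → trans (φ≡ ρ) (total-leaves o (x ∷ xs) ρ)

  -- The discount on the last entry is what allows a prefix to end in an arbitrarily heavy input.
  cost : ℕ → List V → ℕ
  cost e []           = 0
  cost e (x ∷ [])     = 2 ^ a x
  cost e (x ∷ y ∷ xs) = e * 2 ^ a x + cost e (y ∷ xs)

  cost-suc : ∀ e xs → cost e xs ≤ cost (suc e) xs
  cost-suc e []           = z≤n
  cost-suc e (x ∷ [])     = ≤-refl
  cost-suc e (x ∷ y ∷ xs) = +-mono-≤ (m≤n+m (e * 2 ^ a x) (2 ^ a x)) (cost-suc e (y ∷ xs))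

  cost-positive : ∀ e x xs → 0 < cost (suc e) (x ∷ xs)
  cost-positive e x []       = m^n>0 2 (a x)
  cost-positive e x (y ∷ xs) = m≤n⇒m≤o+n _ (cost-positive e y xs)

  cost-≤-weight : ∀ e xs → cost (suc e) xs ≤ suc e * weight a xs
  cost-≤-weight e []       = z≤n
  cost-≤-weight e (x ∷ []) = begin
    2 ^ a x                ≤⟨ m≤m+n (2 ^ a x) 0 ⟩
    2 ^ a x + 0            ≤⟨ m≤n*m (2 ^ a x + 0) (suc e) ⟩
    suc e * (2 ^ a x + 0)  ∎
    where open ≤-Reasoning
  cost-≤-weight e (x ∷ y ∷ xs) = begin
    suc e * 2 ^ a x + cost (suc e) (y ∷ xs)      ≤⟨ +-monoʳ-≤ (suc e * 2 ^ a x) (cost-≤-weight e (y ∷ xs)) ⟩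
    suc e * 2 ^ a x + suc e * weight a (y ∷ xs)  ≡⟨ *-distribˡ-+ (suc e) (2 ^ a x) (weight a (y ∷ xs)) ⟨
    suc e * weight a (x ∷ y ∷ xs)                ∎
    where open ≤-Reasoning

  -- Construction of formulas for `extended`

  extended-[]-formula : ∀ d o x S → weight a (x ∷ S) ≤ 2 ^ d →
    FormulaFor d (extended o (x ∷ S) [])
  extended-[]-formula d o x S w≤ =
    let φ , φ≡ = big-formula d o x S w≤
    in φ , λ ρ → trans (φ≡ ρ) (sym (extended-[] o (x ∷ S) ρ))

  extended-singleton-formula : ∀ d o x S v → weight a (x ∷ S) + 2 ^ a v ≤ 2 ^ d →
    FormulaFor d (extended o (x ∷ S) (v ∷ []))
  extended-singleton-formula d o x S v w≤ =
    let φ , φ≡ = big-formula d o v (x ∷ S) (subst (_≤ 2 ^ d) (+-comm (weight a (x ∷ S)) _) w≤)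
    in φ , λ ρ → trans (φ≡ ρ) (sym (extended-singleton o (x ∷ S) v ρ))

  -- The empty prefix is exempt: only `S` is to be combined then, and `big-formula` does so within
  -- 2^(j+2), while `w` may exceed 2^(j+1).
  Affordable : ℕ → ℕ → List V → Set
  Affordable j w P = P ≡ [] ⊎ w + cost (suc j) P ≤ 2 ^ suc j

  -- Distributing once, t = P ++ y ∷ R with |P| even gives
  -- alt o t = alt o P ⟨dual o⟩ (the even entries of P, and y ⟨o⟩ alt (dual o) R).
  -- Q holds the even entries already passed.
  record Split (j : ℕ) (o : Op) (Q : List V) (w : ℕ) (t : List V) : Set where
    constructor split
    field
      prefix     : List V
      affordable : Affordable j w prefix
      rest       : Formula a (suc (suc j))
      splits     : ∀ ρ → apply o (big o ρ Q) (alt o ρ t) ≡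
                   apply (dual o) (apply o (big o ρ Q) (alt o ρ prefix)) (⟦ rest ⟧ ρ)

  -- The value of `alt o` at `[]` is absorbing for `o` and neutral for `dual o`, so an empty prefix
  -- contributes nothing.
  split-here : ∀ j o Q w y t → FormulaFor (suc (suc j)) (extended o (y ∷ Q) t) → Split j o Q w (y ∷ t)
  split-here j o Q w y t (φ , φ≡) = split [] (inj₁ refl) φ λ ρ → begin
    apply o (big o ρ Q) (alt o ρ (y ∷ t))                             ≡⟨ extended-∷ o Q y t ρ ⟩
    extended o (y ∷ Q) t ρ                                            ≡⟨ φ≡ ρ ⟨
    ⟦ φ ⟧ ρ                                                           ≡⟨ apply-unitˡ (dual o) _ ⟨
    apply (dual o) (unit (dual o)) (⟦ φ ⟧ ρ)                          ≡⟨ cong (λ u → apply (dual o) u (⟦ φ ⟧ ρ)) (apply-absorbing o _) ⟨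
    apply (dual o) (apply o (big o ρ Q) (unit (dual o))) (⟦ φ ⟧ ρ)    ∎
    where open ≡-Reasoning

  -- If `P` is empty, v is the last entry and enjoys the discount, which needs its own bound.
  -- Otherwise y and v are charged in full, and these charges are already in the accumulated weight.
  affordable-∷ : ∀ j w y v P → w + cost (suc j) (y ∷ v ∷ []) ≤ 2 ^ suc j →
    Affordable j (w + (suc j * 2 ^ a y + suc j * 2 ^ a v)) P → Affordable j w (y ∷ v ∷ P)
  affordable-∷ j w y v []       w≤ _           = inj₂ w≤
  affordable-∷ j w y v (p ∷ ps) w≤ (inj₂ w′≤) =
    inj₂ (subst (_≤ 2 ^ suc j) (lemma w (suc j * 2 ^ a y) (suc j * 2 ^ a v) _) w′≤)
    where
    lemma : ∀ w p q r → w + (p + q) + r ≡ w + (p + (q + r))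
    lemma = solve-∀

  -- Let e = j + 1. Along the recursion, `w` accumulates the weight of S plus e times that of the
  -- prefix passed, and `Q` its even entries. The rate e + 1 on the remaining list pays for both.
  split-at-budget : ∀ j o →
    (∀ x Q R → weight a (x ∷ Q) + cost (suc j) R ≤ 2 ^ suc j →
      FormulaFor (suc (suc j)) (extended o (x ∷ Q) R)) →
    ∀ Q w y t → w + weight a Q + cost (suc (suc j)) (y ∷ t) ≤ 2 ^ suc (suc j) → Split j o Q w (y ∷ t)
  -- With at most one entry after y, the rest is a plain combination by `o`, for which the whole
  -- budget 2^(j+2) is available.
  split-at-budget j o build Q w y [] w≤ =
    split-here j o Q w y [] (extended-[]-formula (suc (suc j)) o y Q (begin
      2 ^ a y + weight a Q        ≡⟨ +-comm (2 ^ a y) _ ⟩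
      weight a Q + 2 ^ a y        ≤⟨ +-monoˡ-≤ (2 ^ a y) (m≤n+m (weight a Q) w) ⟩
      w + weight a Q + 2 ^ a y    ≤⟨ w≤ ⟩
      2 ^ suc (suc j)             ∎))
    where open ≤-Reasoning
  split-at-budget j o build Q w y (v ∷ []) w≤ =
    split-here j o Q w y (v ∷ []) (extended-singleton-formula (suc (suc j)) o y Q v (begin
      Y + q + 2 ^ a v                            ≤⟨ m≤n+m _ (w + suc j * Y) ⟩
      w + suc j * Y + (Y + q + 2 ^ a v)          ≡⟨ lemma w (suc j * Y) Y q (2 ^ a v) ⟩
      w + q + (suc (suc j) * Y + 2 ^ a v)        ≤⟨ w≤ ⟩
      2 ^ suc (suc j)                            ∎))
    where
    open ≤-Reasoning
    q = weight a Q
    Y = 2 ^ a y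
    lemma : ∀ w p y q v → w + p + (y + q + v) ≡ w + q + (y + p + v)
    lemma = solve-∀
  split-at-budget j o build Q w y (v ∷ r ∷ rs) w≤
    with weight a (y ∷ Q) + cost (suc j) (v ∷ r ∷ rs) ≤? 2 ^ suc j
  ... | yes fits = split-here j o Q w y (v ∷ r ∷ rs) (build y Q (v ∷ r ∷ rs) fits)
  ... | no  over =
    let split P aff C C≡ = split-at-budget j o build (y ∷ Q) (w + (e * Y + e * U)) r rs remaining
    in split (y ∷ v ∷ P) (affordable-∷ j w y v P prefix-fits aff) C
         (λ ρ → split-later o Q y v (r ∷ rs) P (⟦ C ⟧ ρ) ρ (C≡ ρ))
    where
    open ≤-Reasoning
    e = suc j
    M = 2 ^ suc j
    q = weight a Q
    Y = 2 ^ a y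
    U = 2 ^ a v
    c = cost e (r ∷ rs)
    c′ = cost (suc e) (r ∷ rs)
    remaining : w + (e * Y + e * U) + (Y + q) + c′ ≤ 2 ^ suc (suc j)
    remaining = begin
      -- Passing y costs e in `w` and 1 in `Q`; passing v costs only e, so one `U` is spare.
      w + (e * Y + e * U) + (Y + q) + c′        ≤⟨ m≤n+m _ U ⟩
      U + (w + (e * Y + e * U) + (Y + q) + c′)  ≡⟨ lemma w (e * Y) (e * U) Y q U c′ ⟩
      w + q + (suc e * Y + (suc e * U + c′))    ≤⟨ w≤ ⟩
      2 ^ suc (suc j)                           ∎
      where
      lemma : ∀ w p r y q u c → u + (w + (p + r) + (y + q) + c) ≡ w + q + (y + p + (u + r + c))
      lemma = solve-∀
    prefix-fits : w + (e * Y + U) ≤ M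
    prefix-fits = +-cancelʳ-≤ M _ _ (begin
      -- The failed test puts more than half of the budget 2M on the other side. What remains covers
      -- the prefix ending in v, charged at the discount `U`.
      w + (e * Y + U) + M                          ≤⟨ +-monoʳ-≤ (w + (e * Y + U)) (<⇒≤ (≰⇒> over)) ⟩
      w + (e * Y + U) + (Y + q + (e * U + c))      ≡⟨ lemma w (e * Y) (e * U) Y q U c ⟩
      w + q + (suc e * Y + (suc e * U + c))        ≤⟨ +-monoʳ-≤ (w + q) (+-monoʳ-≤ (suc e * Y)
                                                        (+-monoʳ-≤ (suc e * U) (cost-suc e (r ∷ rs)))) ⟩
      w + q + (suc e * Y + (suc e * U + c′))       ≤⟨ w≤ ⟩
      M + (M + 0)                                  ≡⟨ cong (M +_) (+-identityʳ M) ⟩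
      M + M                                        ∎)
      where
      lemma : ∀ w p r y q u c → w + (p + u) + (y + q + (r + c)) ≡ w + q + (y + p + (u + r + c))
      lemma = solve-∀

  affordable-formula : ∀ j o x S P →
    (∀ t → weight a (x ∷ S) + cost (suc j) t ≤ 2 ^ suc j →
      FormulaFor (suc (suc j)) (extended o (x ∷ S) t)) →
    weight a (x ∷ S) ≤ 2 ^ suc (suc j) → Affordable j (weight a (x ∷ S)) P →
    FormulaFor (suc (suc j)) (extended o (x ∷ S) P)
  affordable-formula j o x S .[] build w≤ (inj₁ refl) = extended-[]-formula (suc (suc j)) o x S w≤
  affordable-formula j o x S P   build w≤ (inj₂ P≤)   = build P P≤

  -- Induction on j: each half has delay j + 2 by the case below or by `kraft`, and one gate `o`
  -- joins them.
  extended-formula : ∀ j o x S t → weight a (x ∷ S) + cost (suc j) t ≤ 2 ^ suc j →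
    FormulaFor (suc (suc j)) (extended o (x ∷ S) t)
  extended-formula j o x S [] w≤ =
    extended-[]-formula (suc (suc j)) o x S
      (m≤n⇒m≤n+o _ (m+n≤o⇒m≤o (weight a (x ∷ S)) w≤))
  extended-formula zero o x S (y ∷ []) w≤ =
    extended-singleton-formula 2 o x S y (m≤n⇒m≤o+n 2 w≤)
  -- Three inputs weigh at least 3, but the budget is 2.
  extended-formula zero o x S (y ∷ v ∷ t) w≤ =
    ⊥-elim (<⇒≱ (+-mono-≤ (weight-nonempty a x S)
      (+-mono-≤ (m≤n⇒m≤n+o 0 (m^n>0 2 (a y))) (cost-positive 0 v t))) w≤)
  extended-formula (suc j) o x S (y ∷ t) w≤ =
    node o (proj₁ A) rest , λ ρ → begin
      apply o (⟦ proj₁ A ⟧ ρ) (⟦ rest ⟧ ρ)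
        ≡⟨ cong (λ u → apply o u (⟦ rest ⟧ ρ)) (proj₂ A ρ) ⟩
      apply o (apply o (big o ρ (x ∷ S)) (alt (dual o) ρ prefix)) (⟦ rest ⟧ ρ)
        ≡⟨ apply-assoc o _ _ _ ⟩
      apply o (big o ρ (x ∷ S)) (apply o (alt (dual o) ρ prefix) (⟦ rest ⟧ ρ))
        ≡⟨ cong (apply o _) (splits′ ρ) ⟨
      extended o (x ∷ S) (y ∷ t) ρ
        ∎
    where
    open ≡-Reasoning
    w = weight a (x ∷ S)
    -- The alternation starts with `dual o`, so the split distributes over `o`, the top gate. `S`
    -- stays with the prefix and enters here only by its weight.
    open Split (split-at-budget j (dual o) (extended-formula j (dual o)) [] w y t
      (subst (λ u → u + cost (suc (suc j)) (y ∷ t) ≤ 2 ^ suc (suc j)) (sym (+-identityʳ w)) w≤))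
    A : FormulaFor (suc (suc j)) (extended o (x ∷ S) prefix)
    A = affordable-formula j o x S prefix (extended-formula j o x S) (m+n≤o⇒m≤o w w≤) affordable
    splits′ : ∀ ρ → alt (dual o) ρ (y ∷ t) ≡ apply o (alt (dual o) ρ prefix) (⟦ rest ⟧ ρ)
    splits′ ρ = begin
      alt (dual o) ρ (y ∷ t)
        ≡⟨ apply-unitˡ (dual o) _ ⟨
      apply (dual o) (unit (dual o)) (alt (dual o) ρ (y ∷ t))
        ≡⟨ splits ρ ⟩
      apply (dual (dual o)) (apply (dual o) (unit (dual o)) (alt (dual o) ρ prefix)) (⟦ rest ⟧ ρ)
        ≡⟨ cong₂ (λ p u → apply p u (⟦ rest ⟧ ρ)) (dual-involutive o) (apply-unitˡ (dual o) _) ⟩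
      apply o (alt (dual o) ρ prefix) (⟦ rest ⟧ ρ)
        ∎

-- From formulas to circuits

Bounded : {V : Set} (a : V → ℕ) (D : ℕ) {j : ℕ} → Gates V j → Set
Bounded a D {j} gs = (i : Fin j) → nodeDelay a gs (inj₂ i) ≤ D

-- The right subformula is compiled on top of the left one, so `embed` must carry the left output
-- along with its value and delay. `d` bounds the new output, `D` every gate.
record Extension {V : Set} (a : V → ℕ) (D : ℕ) {j d : ℕ} (gs : Gates V j) (φ : Formula a d) : Set where
  field
    size        : ℕ
    gates       : Gates V size
    embed       : Node V j → Node V size
    eval-embed  : ∀ ρ v → evalN ρ gates (embed v) ≡ evalN ρ gs v
    delay-embed : ∀ v → nodeDelay a gates (embed v) ≡ nodeDelay a gs v
    out         : Node V size
    eval-out    : ∀ ρ → evalN ρ gates out ≡ ⟦ φ ⟧ ρ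
    delay-out   : nodeDelay a gates out ≤ d
    bounded     : Bounded a D gates

compile : ∀ {V : Set} {a : V → ℕ} {D j d} (gs : Gates V j) → Bounded a D gs →
  (φ : Formula a d) → d ≤ D → Extension a D gs φ
compile gs gs≤ (var x x≤) d≤D = record
  { size = _ ; gates = gs
  ; embed = λ v → v ; eval-embed = λ _ _ → refl ; delay-embed = λ _ → refl
  ; out = inj₁ x ; eval-out = λ _ → refl ; delay-out = x≤
  ; bounded = gs≤ }
compile {V} {a} {D} {j} {suc d} gs gs≤ (node o l r) d<D = record
  { size = suc R.size ; gates = γ ∷ R.gates
  ; embed = λ v → older (R.embed (L.embed v))
  ; eval-embed = λ ρ v → trans (eval-older ρ (R.embed (L.embed v)))
      (trans (R.eval-embed ρ (L.embed v)) (L.eval-embed ρ v))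
  ; delay-embed = λ v → trans (delay-older (R.embed (L.embed v)))
      (trans (R.delay-embed (L.embed v)) (L.delay-embed v))
  ; out = inj₂ zero
  ; eval-out = λ ρ → cong₂ (apply o) (trans (R.eval-embed ρ L.out) (L.eval-out ρ)) (R.eval-out ρ)
  ; delay-out = delay-γ
  ; bounded = λ { zero → ≤-trans delay-γ d<D ; (suc i) → R.bounded i } }
  where
  d≤D = <⇒≤ d<D
  module L = Extension (compile gs gs≤ l d≤D)
  module R = Extension (compile L.gates L.bounded r d≤D)
  γ : Gate V R.size
  γ = gate o (R.embed L.out) R.out
  older : Node V R.size → Node V (suc R.size)
  older (inj₁ x) = inj₁ x
  older (inj₂ i) = inj₂ (suc i)
  eval-older : ∀ ρ v → evalN ρ (γ ∷ R.gates) (older v) ≡ evalN ρ R.gates v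
  eval-older ρ (inj₁ x) = refl
  eval-older ρ (inj₂ i) = refl
  delay-older : ∀ v → nodeDelay a (γ ∷ R.gates) (older v) ≡ nodeDelay a R.gates v
  delay-older (inj₁ x) = refl
  delay-older (inj₂ i) = refl
  delay-γ : nodeDelay a (γ ∷ R.gates) (inj₂ zero) ≤ suc d
  delay-γ = s≤s (⊔-lub (subst (_≤ d) (sym (R.delay-embed L.out)) L.delay-out) R.delay-out)

formula⇒circuit : ∀ {V : Set} {a : V → ℕ} {d F} → (∀ x → a x ≤ d) → FormulaFor {a = a} d F →
  Σ (Circuit V) (λ C → Realizes C F × DelayAtMost a C d)
formula⇒circuit a≤ (φ , φ≡) =
  circuit E.size E.gates E.out , (λ ρ → trans (E.eval-out ρ) (φ≡ ρ)) , a≤ , E.bounded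
  where module E = Extension (compile [] (λ ()) φ ≤-refl)

-- From lists to tuples

alt-AND-tabulate : ∀ {V : Set} {k} (ρ : V → Bool) (t : Fin (suc k) → V) →
  alt AND ρ (tabulate t) ≡ g (ρ ∘ t)
alt-OR-tabulate : ∀ {V : Set} {k} (ρ : V → Bool) (t : Fin (suc k) → V) →
  alt OR ρ (tabulate t) ≡ g* (ρ ∘ t)
alt-AND-tabulate {k = zero}  ρ t = ∧-identityʳ _
alt-AND-tabulate {k = suc k} ρ t = cong (ρ (t zero) ∧_) (alt-OR-tabulate ρ (t ∘ suc))
alt-OR-tabulate {k = zero}  ρ t = ∨-identityʳ _
alt-OR-tabulate {k = suc k} ρ t = cong (ρ (t zero) ∨_) (alt-AND-tabulate ρ (t ∘ suc))

big-AND-tabulate : ∀ {V : Set} {n} (ρ : V → Bool) (s : Fin n → V) →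
  big AND ρ (tabulate s) ≡ andFin (ρ ∘ s)
big-AND-tabulate {n = zero}  ρ s = refl
big-AND-tabulate {n = suc n} ρ s = cong (ρ (s zero) ∧_) (big-AND-tabulate ρ (s ∘ suc))

weight-tabulate : ∀ {V : Set} {n} (a : V → ℕ) (s : Fin n → V) → weight a (tabulate s) ≡ W (a ∘ s)
weight-tabulate {n = zero}  a s = refl
weight-tabulate {n = suc n} a s = cong (2 ^ a (s zero) +_) (weight-tabulate a (s ∘ suc))

sList : ∀ n k → List (Var n k)
sList n k = tabulate inj₁

tTail : ∀ n k → List (Var n k)
tTail n k = tabulate (λ i → inj₂ (suc i))

-- Moving t₀ to the front of s keeps the list nonempty even for n = 0.
extended-sList-tTail : ∀ n k (ρ : Var n k → Bool) →
  extended AND (inj₂ zero ∷ sList n k) (tTail n k) ρ ≡ f ρ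
extended-sList-tTail n k ρ = begin
  extended AND (inj₂ zero ∷ sList n k) (tTail n k) ρ
    ≡⟨ extended-∷ AND (sList n k) (inj₂ zero) (tTail n k) ρ ⟨
  big AND ρ (sList n k) ∧ alt AND ρ (tabulate inj₂)
    ≡⟨ cong₂ _∧_ (big-AND-tabulate ρ inj₁) (alt-AND-tabulate ρ inj₂) ⟩
  f ρ
    ∎
  where open ≡-Reasoning

-- The numerical hypothesis and the conclusion

2^-cancel-≤ : ∀ {m n} → 2 ^ m ≤ 2 ^ n → m ≤ n
2^-cancel-≤ p = ≮⇒≥ (λ n<m → <⇒≱ (^-monoʳ-< 2 ≤-refl n<m) p)

entry-≤-W : ∀ {n} (a : Fin n → ℕ) i → 2 ^ a i ≤ W a
entry-≤-W a zero    = m≤m+n _ _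
entry-≤-W a (suc i) = m≤n⇒m≤o+n _ (entry-≤-W (a ∘ suc) i)

-- 1.9 (d - 1) ≤ d log₂ d
2^[19[d-1]]≤d^[10d] : ∀ j → 2 ^ (19 * suc j) ≤ suc (suc j) ^ (10 * suc (suc j))
-- d = 2 and d = 3 are compared directly; from d = 4 on, log₂ d is at least 2.
2^[19[d-1]]≤d^[10d] zero       = ^-monoʳ-≤ 2 (n≤1+n 19)
2^[19[d-1]]≤d^[10d] (suc zero) = ≤ᵇ⇒≤ (2 ^ 38) (3 ^ 30) _
2^[19[d-1]]≤d^[10d] (suc (suc j)) = begin
  2 ^ (19 * suc (suc (suc j)))   ≤⟨ ^-monoʳ-≤ 2 (*-mono-≤ (n≤1+n 19) (n≤1+n (suc (suc (suc j))))) ⟩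
  2 ^ (20 * d)                   ≡⟨ cong (2 ^_) (*-assoc 2 10 d) ⟩
  2 ^ (2 * (10 * d))             ≡⟨ ^-*-assoc 2 2 (10 * d) ⟨
  4 ^ (10 * d)                   ≤⟨ ^-monoˡ-≤ (10 * d) (m≤m+n 4 j) ⟩
  d ^ (10 * d)                   ∎
  where
  open ≤-Reasoning
  d = 4 + j

-- The premise is 10 T d log₂ d ≤ 19 B in exponential form. Raising the preceding inequality to the
-- power T allows comparing exponents of 2.
linear-budget : ∀ j T B → suc (suc j) ^ (10 * T * suc (suc j)) ≤ 2 ^ (19 * B) → suc j * T ≤ B
linear-budget j T B h = *-cancelˡ-≤ 19 (2^-cancel-≤ (begin
  2 ^ (19 * (suc j * T))    ≡⟨ cong (2 ^_) (*-assoc 19 (suc j) T) ⟨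
  2 ^ (19 * suc j * T)      ≡⟨ ^-*-assoc 2 (19 * suc j) T ⟨
  (2 ^ (19 * suc j)) ^ T    ≤⟨ ^-monoˡ-≤ T (2^[19[d-1]]≤d^[10d] j) ⟩
  (d ^ (10 * d)) ^ T        ≡⟨ ^-*-assoc d (10 * d) T ⟩
  d ^ (10 * d * T)          ≡⟨ cong (d ^_) (lemma d T) ⟩
  d ^ (10 * T * d)          ≤⟨ h ⟩
  2 ^ (19 * B)              ∎))
  where
  open ≤-Reasoning
  d = suc (suc j)
  lemma : ∀ d T → 10 * d * T ≡ 10 * T * d
  lemma = solve-∀

theorem3p2 : (d w n k : ℕ) → 1 < d → w < 2 ^ (d ∸ 1) →
    (a : Var n k → ℕ) →
    W (λ i → a (inj₁ i)) ≡ w →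
    d ^ (10 * W (λ j → a (inj₂ j)) * d) ≤ 2 ^ (19 * (2 ^ (d ∸ 1) ∸ w)) →
    Σ (Circuit (Var n k)) (λ C → Realizes C f × DelayAtMost a C d)
theorem3p2 (suc (suc j)) w n k (s≤s (s≤s _)) w< a refl h =
  formula⇒circuit (λ x → m≤n⇒m≤1+n (arrival≤ x))
    (proj₁ F , λ ρ → trans (proj₂ F ρ) (extended-sList-tTail n k ρ))
  where
  open ≤-Reasoning
  T = W (a ∘ inj₂)
  T′ = W (λ i → a (inj₂ (suc i)))
  t₀ = 2 ^ a (inj₂ zero)
  budget : w + suc j * T ≤ 2 ^ suc j
  budget = subst (_≤ 2 ^ suc j) (+-comm _ w)
    (m≤o∸n⇒m+n≤o _ (<⇒≤ w<) (linear-budget j T (2 ^ suc j ∸ w) h))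
  arrival≤ : ∀ x → a x ≤ suc j
  arrival≤ (inj₁ i) = 2^-cancel-≤ (≤-trans (entry-≤-W (a ∘ inj₁) i) (<⇒≤ w<))
  arrival≤ (inj₂ i) = 2^-cancel-≤ (begin
    2 ^ a (inj₂ i)   ≤⟨ entry-≤-W (a ∘ inj₂) i ⟩
    T                ≤⟨ m≤n*m T (suc j) ⟩
    suc j * T        ≤⟨ m+n≤o⇒n≤o w budget ⟩
    2 ^ suc j        ∎)
  affordable : weight a (inj₂ zero ∷ sList n k) + cost (suc j) (tTail n k) ≤ 2 ^ suc j
  affordable = begin
    t₀ + weight a (sList n k) + cost (suc j) (tTail n k)
      ≤⟨ +-monoʳ-≤ (t₀ + weight a (sList n k)) (cost-≤-weight j (tTail n k)) ⟩
    t₀ + weight a (sList n k) + suc j * weight a (tTail n k)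
      ≡⟨ cong₂ (λ u v → t₀ + u + suc j * v) (weight-tabulate a inj₁) (weight-tabulate a (λ i → inj₂ (suc i))) ⟩
    -- As a member of `S`, t₀ is charged once instead of j + 1 times.
    t₀ + w + suc j * T′                ≤⟨ m≤m+n _ (j * t₀) ⟩
    t₀ + w + suc j * T′ + j * t₀       ≡⟨ lemma t₀ w j T′ ⟩
    w + suc j * T                      ≤⟨ budget ⟩
    2 ^ suc j                          ∎
    where
    lemma : ∀ x w j y → x + w + suc j * y + j * x ≡ w + suc j * (x + y)
    lemma = solve-∀
  F : FormulaFor (suc (suc j)) (extended AND (inj₂ zero ∷ sList n k) (tTail n k))
  F = extended-formula j AND (inj₂ zero) (sList n k) (tTail n k) affordable
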